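{- Let $A, B \subseteq \omega$ be computably enumerable sets such that $A \equiv_{wtt} B$, $A \cap B = \emptyset$, and $\omega \setminus (A \cup B)$ is infinite. Then for every set $C \subseteq \omega$ with $C \ge_T A$, there is a separator $Z$ of $A$ and $B$ such that $Z \equiv_T C$.
   Context: A separator of disjoint sets $A, B \subseteq \omega$ is a set $Z \subseteq \omega$ with $A \subseteq Z$ and $Z \cap B = \emptyset$. Here $\le_T$ is Turing reducibility, and $\le_{wtt}$ is weak truth table reducibility: $X \le_{wtt} Y$ if $X$ is computed from oracle $Y$ by a Turing functional whose use on that computation is bounded by a computable function of the input. $A \equiv_{wtt} B$ means $A \le_{wtt} B$ and $B \le_{wtt} A$; $\equiv_T$ is defined analogously. -}

module Defs where

open import Level using (0ℓ)
open import Data.Nat using (ℕ; zero; suc; _⊔_; _≤_)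
open import Data.Fin using (Fin)
open import Data.List using (List)
open import Data.List.Membership.Propositional using () renaming (_∈_ to _∈ˡ_)
open import Data.Product using (_×_; ∃-syntax; Σ-syntax)
open import Data.Sum using (_⊎_)
open import Data.Vec using (Vec; []; _∷_; lookup)
open import Function.Bundles using (_⇔_)
open import Relation.Nullary using (¬_)
open import Relation.Unary using (Pred; _∈_; _∉_; _⊆_; _∩_; ∅; Empty)
open import Relation.Binary.PropositionalEquality using (_≡_)

Subset : Set₁
Subset = Pred ℕ 0ℓ

-- The graph of the characteristic function of X.
data χ (X : Subset) (x : ℕ) : ℕ → Set where
  inside  : x ∈ X → χ X x 1
  outside : x ∉ X → χ X x 0

-- Turing functionals, presented as programs for the functions that are
-- partial recursive in an oracle (Kleene).
data Code : ℕ → Set where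
  zer    : Code 0
  succ   : Code 1
  proj   : ∀ {n} → Fin n → Code n
  oracle : Code 1
  comp   : ∀ {m n} → Code m → Vec (Code n) m → Code n
  prec   : ∀ {n} → Code n → Code (suc (suc n)) → Code (suc n)
  mu     : ∀ {n} → Code (suc n) → Code n

infix 4 _⊢_[_]⇓_ _⊢_[_]⇓*_ _⊢mu_[_]from_⇓_

mutual

  -- Y ⊢ e [ xs ]⇓ v : program e with oracle Y halts on xs with output v.
  data _⊢_[_]⇓_ (Y : Subset) : ∀ {n} → Code n → Vec ℕ n → ℕ → Set where
    ⇓zer    : Y ⊢ zer [ [] ]⇓ 0
    ⇓succ   : ∀ {x} → Y ⊢ succ [ x ∷ [] ]⇓ suc x
    ⇓proj   : ∀ {n} {i : Fin n} {xs} → Y ⊢ proj i [ xs ]⇓ lookup xs i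
    ⇓oracle : ∀ {x v} → χ Y x v → Y ⊢ oracle [ x ∷ [] ]⇓ v
    ⇓comp   : ∀ {m n} {f : Code m} {gs : Vec (Code n) m} {xs ys v} →
              Y ⊢ gs [ xs ]⇓* ys → Y ⊢ f [ ys ]⇓ v →
              Y ⊢ comp f gs [ xs ]⇓ v
    ⇓prec0  : ∀ {n} {f : Code n} {g xs v} →
              Y ⊢ f [ xs ]⇓ v →
              Y ⊢ prec f g [ 0 ∷ xs ]⇓ v
    ⇓precS  : ∀ {n} {f : Code n} {g xs k r v} →
              Y ⊢ prec f g [ k ∷ xs ]⇓ r → Y ⊢ g [ k ∷ r ∷ xs ]⇓ v →
              Y ⊢ prec f g [ suc k ∷ xs ]⇓ v
    ⇓mu     : ∀ {n} {f : Code (suc n)} {xs v} →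
              Y ⊢mu f [ xs ]from 0 ⇓ v →
              Y ⊢ mu f [ xs ]⇓ v

  data _⊢_[_]⇓*_ (Y : Subset) {n : ℕ} :
       ∀ {m} → Vec (Code n) m → Vec ℕ n → Vec ℕ m → Set where
    ⇓[] : ∀ {xs} → Y ⊢ [] [ xs ]⇓* []
    ⇓∷  : ∀ {m} {g : Code n} {gs : Vec (Code n) m} {xs y ys} →
          Y ⊢ g [ xs ]⇓ y → Y ⊢ gs [ xs ]⇓* ys →
          Y ⊢ (g ∷ gs) [ xs ]⇓* (y ∷ ys)

  -- Y ⊢mu f [ xs ]from k ⇓ v : v is the least v ≥ k with f (v , xs) = 0,
  -- and f (i , xs) converges for all k ≤ i < v.
  data _⊢mu_[_]from_⇓_ (Y : Subset) {n : ℕ} (f : Code (suc n)) (xs : Vec ℕ n) :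
       ℕ → ℕ → Set where
    found : ∀ {k} → Y ⊢ f [ k ∷ xs ]⇓ 0 → Y ⊢mu f [ xs ]from k ⇓ k
    next  : ∀ {k w v} → Y ⊢ f [ k ∷ xs ]⇓ suc w →
            Y ⊢mu f [ xs ]from suc k ⇓ v →
            Y ⊢mu f [ xs ]from k ⇓ v

-- The use of a computation: one more than the largest number queried
-- (0 if there are no queries).
mutual

  use : ∀ {Y n} {e : Code n} {xs v} → Y ⊢ e [ xs ]⇓ v → ℕ
  use ⇓zer                = 0
  use ⇓succ               = 0
  use ⇓proj               = 0
  use (⇓oracle {x = x} _) = suc x
  use (⇓comp ds d)        = use* ds ⊔ use d
  use (⇓prec0 d)          = use d
  use (⇓precS d d′)       = use d ⊔ use d′
  use (⇓mu d)             = useμ d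

  use* : ∀ {Y m n} {gs : Vec (Code n) m} {xs ys} → Y ⊢ gs [ xs ]⇓* ys → ℕ
  use* ⇓[]       = 0
  use* (⇓∷ d ds) = use d ⊔ use* ds

  useμ : ∀ {Y n} {f : Code (suc n)} {xs k v} → Y ⊢mu f [ xs ]from k ⇓ v → ℕ
  useμ (found d)   = use d
  useμ (next d d′) = use d ⊔ useμ d′

-- Queries to the empty oracle are always answered 0, so they add no power.
Computable : (ℕ → ℕ) → Set
Computable f = ∃[ e ] (∀ x → ∅ ⊢ e [ x ∷ [] ]⇓ f x)

CE : Subset → Set
CE A = Empty A ⊎ ∃[ f ] (Computable f × (∀ x → x ∈ A ⇔ (∃[ n ] f n ≡ x)))

infix 4 _≤T_ _≤wtt_ _≡T_ _≡wtt_

_≤T_ : Subset → Subset → Set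
X ≤T Y = ∃[ e ] (∀ x → ∃[ v ] (χ X x v × Y ⊢ e [ x ∷ [] ]⇓ v))

_≤wtt_ : Subset → Subset → Set
X ≤wtt Y = ∃[ e ] ∃[ f ] (Computable f ×
  (∀ x → ∃[ v ] (χ X x v × (Σ[ d ∈ Y ⊢ e [ x ∷ [] ]⇓ v ] use d ≤ f x))))

_≡T_ : Subset → Subset → Set
X ≡T Y = X ≤T Y × Y ≤T X

_≡wtt_ : Subset → Subset → Set
X ≡wtt Y = X ≤wtt Y × Y ≤wtt X

Finite : Subset → Set
Finite X = ∃[ xs ] (∀ x → x ∈ X → x ∈ˡ xs)

Infinite : Subset → Set
Infinite X = ¬ Finite X

Separator : Subset → Subset → Subset → Set
Separator A B Z = A ⊆ Z × Empty (Z ∩ B)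

{-# OPTIONS --safe #-}
module Submission where

-- Let h be computable, monotone and above the uses of both wtt-reductions, and
-- let D be the complement of A ∪ B. If Z contains none or all of D on the block
-- [m, h m), then Z = A or ∁ Z = B there, and Z can wait for a stage of the
-- enumerations at which one of the two is confirmed. If A and B are already known
-- below m, then one of them is now known below h m, and the wtt-reductions give
-- both at m. Hence a Z which is homogeneous on all blocks computes A and B. If
-- infinitely many blocks miss D, homogeneity still leaves one free bit between
-- any two such gaps. Otherwise almost all blocks meet D, and a bit written
-- homogeneously on a block can be read off by waiting as above, without knowing
-- A and B below the block.

open import Defs
open import Level using (0ℓ)
open import Axiom.ExcludedMiddle using (ExcludedMiddle)
open import Data.Empty using (⊥-elim)
open import Data.Fin using (Fin; zero; suc)
open import Data.Fin.Patterns using (0F; 1F; 2F)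
open import Data.List using (upTo)
open import Data.List.Membership.Propositional.Properties using (∈-upTo⁺)
open import Data.Nat using (ℕ; zero; suc; pred; _+_; _∸_; _⊔_; _≤_; _<_; z≤n; s≤s)
open import Data.Nat.Properties
open import Data.Product using (_×_; _,_; proj₁; proj₂; uncurry; ∃-syntax; Σ-syntax)
open import Data.Sum using (_⊎_; inj₁; inj₂; [_,_]′)
open import Data.Vec using (Vec; []; _∷_; lookup; tabulate)
open import Function using (_∘_; id)
open import Function.Bundles using (_⇔_; mk⇔; Equivalence)
open import Relation.Binary.PropositionalEquality using (_≡_; refl; sym; trans; cong; subst)
open import Relation.Binary.Definitions using (tri<; tri≈; tri>)
open import Relation.Nullary using (¬_; Dec; yes; no)
open import Relation.Unary using (_⊆_; _∩_; _∪_; ∁; ∅; Empty)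

private variable
  m n : ℕ
  I J : Set
  X Y : Subset

-- Simulating an oracle by a program.

projections : (Fin m → Fin n) → Vec (Code n) m
projections g = tabulate (proj ∘ g)

⇓projections : ∀ {xs : Vec ℕ n} {ys : Vec ℕ m} (g : Fin m → Fin n) →
  (∀ i → lookup xs (g i) ≡ lookup ys i) → Y ⊢ projections g [ xs ]⇓* ys
⇓projections {ys = []}     g eq = ⇓[]
⇓projections {Y = Y} {xs = xs} {ys = y ∷ ys} g eq =
  ⇓∷ (subst (Y ⊢ proj (g zero) [ xs ]⇓_) (eq zero) ⇓proj) (⇓projections (g ∘ suc) (eq ∘ suc))

-- Replaces oracle calls by calls to q, passing a parameter p (the new first
-- argument) along: the oracle becomes the set { y | q (p , y) = 1 }.
module Simulation (q : Code 2) where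

  mutual

    sim : Code n → Code (suc n)
    sim zer         = comp zer []
    sim succ        = comp succ (proj 1F ∷ [])
    sim (proj i)    = proj (suc i)
    sim oracle      = q
    sim (comp f gs) = comp (sim f) (proj 0F ∷ sim* gs)
    -- `prec` and `mu` reserve the first argument for themselves, so inside them the parameter sits
    -- behind it; `sim-step` and `sim-test` move it back to the front.
    sim (prec f g)  = comp (prec (sim f) (sim-step g)) (proj 1F ∷ proj 0F ∷ projections (λ i → suc (suc i)))
    sim (mu f)      = mu (sim-test f)

    sim* : Vec (Code n) m → Vec (Code (suc n)) m
    sim* []       = []
    sim* (g ∷ gs) = sim g ∷ sim* gs

    sim-step : Code (suc (suc n)) → Code (suc (suc (suc n)))
    sim-step g = comp (sim g) (proj 2F ∷ proj 0F ∷ proj 1F ∷ projections (λ i → suc (suc (suc i))))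

    sim-test : Code (suc n) → Code (suc (suc n))
    sim-test f = comp (sim f) (proj 1F ∷ proj 0F ∷ projections (λ i → suc (suc i)))

  module _ {p b : ℕ} (answer : ∀ {y v} → y < b → χ X y v → Y ⊢ q [ p ∷ y ∷ [] ]⇓ v) where

    mutual

      -- Induction on the derivation. Its use is at most `b`, so every query lies below `b` and `q`
      -- has to answer correctly only there.
      ⇓sim : ∀ {e : Code n} {xs v} (d : X ⊢ e [ xs ]⇓ v) → use d ≤ b → Y ⊢ sim e [ p ∷ xs ]⇓ v
      ⇓sim ⇓zer         _ = ⇓comp ⇓[] ⇓zer
      ⇓sim ⇓succ        _ = ⇓comp (⇓∷ ⇓proj ⇓[]) ⇓succ
      ⇓sim ⇓proj        _ = ⇓proj
      ⇓sim (⇓oracle c)  u = answer u c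
      ⇓sim (⇓comp ds d) u =
        ⇓comp (⇓∷ ⇓proj (⇓sim* ds (m⊔n≤o⇒m≤o (use* ds) (use d) u))) (⇓sim d (m⊔n≤o⇒n≤o (use* ds) (use d) u))
      ⇓sim (⇓prec0 d)   u =
        ⇓comp (⇓∷ ⇓proj (⇓∷ ⇓proj (⇓projections _ (λ _ → refl)))) (⇓sim-prec (⇓prec0 d) u)
      ⇓sim (⇓precS d d′) u =
        ⇓comp (⇓∷ ⇓proj (⇓∷ ⇓proj (⇓projections _ (λ _ → refl)))) (⇓sim-prec (⇓precS d d′) u)
      ⇓sim (⇓mu d)      u = ⇓mu (⇓sim-mu d u)

      ⇓sim* : ∀ {gs : Vec (Code n) m} {xs ys} (d : X ⊢ gs [ xs ]⇓* ys) → use* d ≤ b → Y ⊢ sim* gs [ p ∷ xs ]⇓* ys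
      ⇓sim* ⇓[]       _ = ⇓[]
      ⇓sim* (⇓∷ d ds) u =
        ⇓∷ (⇓sim d (m⊔n≤o⇒m≤o (use d) (use* ds) u)) (⇓sim* ds (m⊔n≤o⇒n≤o (use d) (use* ds) u))

      ⇓sim-prec : ∀ {f : Code n} {g k xs v} (d : X ⊢ prec f g [ k ∷ xs ]⇓ v) → use d ≤ b →
        Y ⊢ prec (sim f) (sim-step g) [ k ∷ p ∷ xs ]⇓ v
      ⇓sim-prec (⇓prec0 d)    u = ⇓prec0 (⇓sim d u)
      ⇓sim-prec (⇓precS d d′) u = ⇓precS (⇓sim-prec d (m⊔n≤o⇒m≤o (use d) (use d′) u))
        (⇓comp (⇓∷ ⇓proj (⇓∷ ⇓proj (⇓∷ ⇓proj (⇓projections _ (λ _ → refl)))))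
          (⇓sim d′ (m⊔n≤o⇒n≤o (use d) (use d′) u)))

      ⇓sim-test : ∀ {f : Code (suc n)} {k xs v} (d : X ⊢ f [ k ∷ xs ]⇓ v) → use d ≤ b →
        Y ⊢ sim-test f [ k ∷ p ∷ xs ]⇓ v
      ⇓sim-test d u = ⇓comp (⇓∷ ⇓proj (⇓∷ ⇓proj (⇓projections _ (λ _ → refl)))) (⇓sim d u)

      ⇓sim-mu : ∀ {f : Code (suc n)} {k xs v} (d : X ⊢mu f [ xs ]from k ⇓ v) → useμ d ≤ b →
        Y ⊢mu sim-test f [ p ∷ xs ]from k ⇓ v
      ⇓sim-mu (found d)   u = found (⇓sim-test d u)
      ⇓sim-mu (next d d′) u =
        next (⇓sim-test d (m⊔n≤o⇒m≤o (use d) (useμ d′) u)) (⇓sim-mu d′ (m⊔n≤o⇒n≤o (use d) (useμ d′) u))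

-- Functions computable in an oracle.

-- f i is computable in Y, uniformly in i, from the numbers ρ i. Restricting
-- the index type I restricts the inputs on which the program must halt.
record Computes (Y : Subset) {I : Set} {n : ℕ} (ρ : I → Vec ℕ n) (f : I → ℕ) : Set where
  constructor computes
  field
    code    : Code n
    correct : ∀ i → Y ⊢ code [ ρ i ]⇓ f i

record Computes* (Y : Subset) {I : Set} {m n : ℕ} (ρ : I → Vec ℕ n) (φ : I → Vec ℕ m) : Set where
  constructor computes*
  field
    codes    : Vec (Code n) m
    correct* : ∀ i → Y ⊢ codes [ ρ i ]⇓* φ i

unary : ℕ → Vec ℕ 1
unary x = x ∷ []

binary : ℕ × ℕ → Vec ℕ 2
binary p = proj₁ p ∷ proj₂ p ∷ []

infixl 6 _▸
_▸ : (I → Vec ℕ n) → I × ℕ → Vec ℕ (suc n)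
(ρ ▸) p = proj₂ p ∷ ρ (proj₁ p)

private variable
  ρ     : I → Vec ℕ n
  f g t : I → ℕ

nil : Computes* Y ρ (λ _ → [])
nil = computes* [] (λ _ → ⇓[])

infixr 5 _◂_
_◂_ : {φ : I → Vec ℕ m} → Computes Y ρ f → Computes* Y ρ φ → Computes* Y ρ (λ i → f i ∷ φ i)
computes e c ◂ computes* es cs = computes* (e ∷ es) (λ i → ⇓∷ (c i) (cs i))

select : {ρ : I → Vec ℕ n} {φ : I → Vec ℕ m} (g : Fin m → Fin n) →
  (∀ i j → lookup (ρ i) (g j) ≡ lookup (φ i) j) → Computes* Y ρ φ
select g eq = computes* (projections g) (λ i → ⇓projections g (eq i))

compose : {ρ : I → Vec ℕ n} {ρ′ : J → Vec ℕ m} {f : J → ℕ} (φ : I → J) →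
  Computes Y ρ′ f → Computes* Y ρ (ρ′ ∘ φ) → Computes Y ρ (f ∘ φ)
compose φ (computes e c) (computes* es cs) = computes (comp e es) (λ i → ⇓comp (cs i) (c (φ i)))

reindex : {ρ : I → Vec ℕ n} {f : I → ℕ} (φ : J → I) → Computes Y ρ f → Computes Y (ρ ∘ φ) (f ∘ φ)
reindex φ (computes e c) = computes e (c ∘ φ)

computes-cong : (∀ i → f i ≡ g i) → Computes Y ρ f → Computes Y ρ g
computes-cong {Y = Y} {ρ = ρ} eq (computes e c) = computes e (λ i → subst (Y ⊢ e [ ρ i ]⇓_) (eq i) (c i))

var : {ρ : I → Vec ℕ n} (k : Fin n) → Computes Y ρ (λ i → lookup (ρ i) k)
var k = computes (proj k) (λ _ → ⇓proj)

weaken : Computes Y ρ f → Computes Y (ρ ▸) (f ∘ proj₁)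
weaken c = compose proj₁ c (select suc (λ _ _ → refl))

apply₁ : {F : ℕ → ℕ} → Computes Y unary F → Computes Y ρ t → Computes Y ρ (F ∘ t)
apply₁ {t = t} F c = compose t F (c ◂ nil)

apply₂ : {F : ℕ × ℕ → ℕ} → Computes Y binary F → Computes Y ρ f → Computes Y ρ g →
  Computes Y ρ (λ i → F (f i , g i))
apply₂ {f = f} {g = g} F c d = compose (λ i → f i , g i) F (c ◂ d ◂ nil)

suc-computes : Computes Y ρ t → Computes Y ρ (suc ∘ t)
suc-computes (computes e c) = computes (comp succ (e ∷ [])) (λ i → ⇓comp (⇓∷ (c i) ⇓[]) ⇓succ)

const-computes : ∀ k → Computes Y ρ (λ _ → k)
const-computes zero    = computes (comp zer []) (λ _ → ⇓comp ⇓[] ⇓zer)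
const-computes (suc k) = suc-computes (const-computes k)

-- The step program is only ever run on the true value `R i k`, so `R` may be any family of values,
-- even one defined by non-effective means.
recursion : {ρ : I → Vec ℕ n} {t : I → ℕ} (R : I → ℕ → ℕ) →
  Computes Y ρ (λ i → R i 0) →
  Computes Y (λ (p : I × ℕ) → proj₂ p ∷ R (proj₁ p) (proj₂ p) ∷ ρ (proj₁ p)) (λ p → R (proj₁ p) (suc (proj₂ p))) →
  Computes Y ρ t → Computes Y ρ (λ i → R i (t i))
recursion {I = I} {Y = Y} {ρ = ρ} {t = t} R (computes e₀ c₀) (computes e₁ c₁) (computes e c) =
  computes (comp (prec e₀ e₁) (e ∷ projections id))
    (λ i → ⇓comp (⇓∷ (c i) (⇓projections id (λ _ → refl))) (run i (t i)))
  where
  run : ∀ i k → Y ⊢ prec e₀ e₁ [ k ∷ ρ i ]⇓ R i k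
  run i zero    = ⇓prec0 (c₀ i)
  run i (suc k) = ⇓precS (run i k) (c₁ (i , k))

recursion₁ : (R : ℕ → ℕ) → Computes Y (λ k → k ∷ R k ∷ []) (R ∘ suc) → Computes Y unary R
recursion₁ R c = recursion (λ _ → R) (const-computes (R 0))
  (compose proj₂ c (var 0F ◂ var 1F ◂ nil)) (var 0F)

+-computes : Computes Y ρ f → Computes Y ρ g → Computes Y ρ (λ i → f i + g i)
+-computes {f = f} {g = g} cf cg =
  recursion (λ i k → k + g i) cg (suc-computes (var 1F)) cf

pred-computes : Computes Y ρ t → Computes Y ρ (pred ∘ t)
pred-computes = recursion (λ _ → pred) (const-computes 0) (var 0F)

∸-computes : Computes Y ρ f → Computes Y ρ g → Computes Y ρ (λ i → f i ∸ g i)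
∸-computes {f = f} {g = g} cf cg = recursion (λ i k → f i ∸ k) cf
  (computes-cong (λ p → pred[m∸n]≡m∸[1+n] (f (proj₁ p)) (proj₂ p)) (pred-computes (var 1F))) cg

-- The empty oracle is simulated by the constant 0, under a dummy parameter.
computable-computes : {F : ℕ → ℕ} → Computable F → Computes Y unary F
computable-computes (e , c) = computes (comp (sim e) (comp zer [] ∷ proj 0F ∷ []))
  (λ x → ⇓comp (⇓∷ (⇓comp ⇓[] ⇓zer) (⇓∷ ⇓proj ⇓[]))
    (⇓sim {p = 0} (λ { _ (inside ()) ; _ (outside _) → ⇓comp ⇓[] ⇓zer }) (c x) ≤-refl))
  where open Simulation (comp zer [])

-- Predicates decidable in an oracle.

module Classical (em : ExcludedMiddle 0ℓ) where

  private variable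
    P Q : I → Set

  bit : {P : Set} → Dec P → ℕ
  bit (yes _) = 1
  bit (no _)  = 0

  𝟙 : Set → ℕ
  𝟙 P = bit (em {P})

  𝟙-yes : {P : Set} → P → 𝟙 P ≡ 1
  𝟙-yes {P} p with em {P}
  ... | yes _ = refl
  ... | no ¬p = ⊥-elim (¬p p)

  𝟙-no : {P : Set} → ¬ P → 𝟙 P ≡ 0
  𝟙-no {P} ¬p with em {P}
  ... | yes p = ⊥-elim (¬p p)
  ... | no _  = refl

  𝟙-cong : {P Q : Set} → P ⇔ Q → 𝟙 P ≡ 𝟙 Q
  𝟙-cong {P} e with em {P}
  ... | yes p = sym (𝟙-yes (Equivalence.to e p))
  ... | no ¬p = sym (𝟙-no (¬p ∘ Equivalence.from e))

  χ-𝟙 : ∀ x → χ X x (𝟙 (X x))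
  χ-𝟙 {X} x with em {X x}
  ... | yes p = inside p
  ... | no ¬p = outside ¬p

  χ⇒𝟙 : ∀ {x v} → χ X x v → v ≡ 𝟙 (X x)
  χ⇒𝟙 (inside p)   = sym (𝟙-yes p)
  χ⇒𝟙 (outside ¬p) = sym (𝟙-no ¬p)

  by-contradiction : {P : Set} → ¬ ¬ P → P
  by-contradiction {P} ¬¬p with em {P}
  ... | yes p = p
  ... | no ¬p = ⊥-elim (¬¬p ¬p)

  Least : (ℕ → Set) → ℕ → Set
  Least P k = P k × (∀ j → j < k → ¬ P j)

  least-below : (P : ℕ → Set) → ∀ n → (∃[ k ] Least P k) ⊎ (∀ k → k < n → ¬ P k)
  least-below P zero = inj₂ (λ _ ())
  least-below P (suc n) with least-below P n | em {P n}
  ... | inj₁ l | _      = inj₁ l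
  ... | inj₂ ¬p | yes p = inj₁ (n , p , ¬p)
  ... | inj₂ ¬p | no ¬q = inj₂ λ k k<1+n → [ ¬p k , (λ { refl → ¬q }) ]′ (m<1+n⇒m<n∨m≡n k<1+n)

  least : (P : ℕ → Set) → ∃[ k ] P k → ∃[ k ] Least P k
  least P (n , p) with least-below P (suc n)
  ... | inj₁ l  = l
  ... | inj₂ ¬p = ⊥-elim (¬p n ≤-refl p)

  uniform-bound : (P : ℕ → ℕ → Set) → (∀ {x s t} → s ≤ t → P x s → P x t) →
    ∀ n → (∀ x → x < n → ∃[ s ] P x s) → ∃[ s ] (∀ x → x < n → P x s)
  uniform-bound P mono zero    ex = 0 , λ _ ()
  uniform-bound P mono (suc n) ex
    with uniform-bound P mono n (λ x x<n → ex x (m<n⇒m<1+n x<n)) | ex n ≤-refl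
  ... | s , ps | t , pt = s ⊔ t , λ x x<1+n →
    [ (λ x<n → mono (m≤m⊔n s t) (ps x x<n)) , (λ { refl → mono (m≤n⊔m s t) pt }) ]′ (m<1+n⇒m<n∨m≡n x<1+n)

  record Decides (Y : Subset) {I : Set} {n : ℕ} (ρ : I → Vec ℕ n) (P : I → Set) : Set where
    constructor decides
    field
      computes-𝟙 : Computes Y ρ (λ i → 𝟙 (P i))
  open Decides

  decides-cong : (∀ i → P i ⇔ Q i) → Decides Y ρ P → Decides Y ρ Q
  decides-cong e (decides c) = decides (computes-cong (λ i → 𝟙-cong (e i)) c)

  decides-reindex : {ρ : I → Vec ℕ n} {P : I → Set} (φ : J → I) → Decides Y ρ P → Decides Y (ρ ∘ φ) (P ∘ φ)
  decides-reindex φ (decides c) = decides (reindex φ c)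

  decides-weaken : Decides Y ρ P → Decides Y (ρ ▸) (P ∘ proj₁)
  decides-weaken (decides c) = decides (weaken c)

  decides₁ : {P : ℕ → Set} → Decides Y unary P → Computes Y ρ t → Decides Y ρ (P ∘ t)
  decides₁ (decides d) c = decides (apply₁ d c)

  decides₂ : {P : ℕ × ℕ → Set} → Decides Y binary P → Computes Y ρ f → Computes Y ρ g →
    Decides Y ρ (λ i → P (f i , g i))
  decides₂ (decides d) c c′ = decides (apply₂ d c c′)

  -- The program for Q is only run, hence only has to halt, where P holds.
  decides-guarded : {ρ : I → Vec ℕ n} {P Q : I → Set} → Decides Y ρ P →
    Decides Y {I = Σ[ i ∈ I ] P i} (ρ ∘ proj₁) (Q ∘ proj₁) → Decides Y ρ (λ i → P i × Q i)
  decides-guarded {n = n} {Y = Y} {ρ = ρ} {P} {Q} (decides (computes e c)) (decides (computes e′ c′)) =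
    decides (computes (comp conditional (e ∷ projections id))
      (λ i → ⇓comp (⇓∷ (c i) (⇓projections id (λ _ → refl))) (run i)))
    where
    conditional : Code (suc n)
    conditional = prec (comp zer []) (comp e′ (projections (λ i → suc (suc i))))
    run : ∀ i → Y ⊢ conditional [ 𝟙 (P i) ∷ ρ i ]⇓ 𝟙 (P i × Q i)
    run i with em {P i}
    ... | yes p = subst (Y ⊢ conditional [ 1 ∷ ρ i ]⇓_) (𝟙-cong (mk⇔ (p ,_) proj₂))
      (⇓precS (⇓prec0 (⇓comp ⇓[] ⇓zer)) (⇓comp (⇓projections _ (λ _ → refl)) (c′ (i , p))))
    ... | no ¬p = subst (Y ⊢ conditional [ 0 ∷ ρ i ]⇓_) (sym (𝟙-no (¬p ∘ proj₁)))
      (⇓prec0 (⇓comp ⇓[] ⇓zer))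

  decides-× : Decides Y ρ P → Decides Y ρ Q → Decides Y ρ (λ i → P i × Q i)
  decides-× d d′ = decides-guarded d (decides-reindex proj₁ d′)

  decides-¬ : Decides Y ρ P → Decides Y ρ (λ i → ¬ P i)
  decides-¬ {P = P} (decides c) = decides (computes-cong eq (∸-computes (const-computes 1) c))
    where
    eq : ∀ i → 1 ∸ 𝟙 (P i) ≡ 𝟙 (¬ P i)
    eq i with em {P i}
    ... | yes p = sym (𝟙-no (λ ¬p → ¬p p))
    ... | no ¬p = sym (𝟙-yes ¬p)

  decides-⊎ : Decides Y ρ P → Decides Y ρ Q → Decides Y ρ (λ i → P i ⊎ Q i)
  decides-⊎ d d′ = decides-cong
    (λ i → mk⇔ (λ h → by-contradiction (λ ¬s → h (¬s ∘ inj₁ , ¬s ∘ inj₂)))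
               (λ s (¬p , ¬q) → [ ¬p , ¬q ]′ s))
    (decides-¬ (decides-× (decides-¬ d) (decides-¬ d′)))

  -- Each branch has to halt and be right only in its own case, so a branch may run a reduction on
  -- an oracle that is correct only there.
  decides-cases : {ρ : I → Vec ℕ n} {P Q : I → Set} → Decides Y ρ P →
    Decides Y {I = Σ[ i ∈ I ] P i} (ρ ∘ proj₁) (Q ∘ proj₁) →
    Decides Y {I = Σ[ i ∈ I ] (¬ P i)} (ρ ∘ proj₁) (Q ∘ proj₁) → Decides Y ρ Q
  decides-cases {P = P} {Q} d d₁ d₂ = decides-cong (λ i → mk⇔ [ proj₂ , proj₂ ]′ (split i))
    (decides-⊎ (decides-guarded d d₁) (decides-guarded (decides-¬ d) d₂))
    where
    split : ∀ i → Q i → (P i × Q i) ⊎ (¬ P i × Q i)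
    split i q with em {P i}
    ... | yes p = inj₁ (p , q)
    ... | no ¬p = inj₂ (¬p , q)

  decides-→ : Decides Y ρ P → Decides Y ρ Q → Decides Y ρ (λ i → P i → Q i)
  decides-→ d d′ = decides-cong
    (λ i → mk⇔ (λ h p → by-contradiction (λ ¬q → h (p , ¬q))) (λ h (p , ¬q) → ¬q (h p)))
    (decides-¬ (decides-× d (decides-¬ d′)))

  decides-≤ : Computes Y ρ f → Computes Y ρ g → Decides Y ρ (λ i → f i ≤ g i)
  decides-≤ {f = f} {g = g} c c′ = decides
    (computes-cong eq (∸-computes (const-computes 1) (∸-computes c c′)))
    where
    eq : ∀ i → 1 ∸ (f i ∸ g i) ≡ 𝟙 (f i ≤ g i)
    eq i with em {f i ≤ g i}
    ... | yes p = cong (1 ∸_) (m≤n⇒m∸n≡0 p)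
    ... | no ¬p = m≤n⇒m∸n≡0 (m<n⇒0<n∸m (≰⇒> ¬p))

  decides-≡ : Computes Y ρ f → Computes Y ρ g → Decides Y ρ (λ i → f i ≡ g i)
  decides-≡ c c′ = decides-cong (λ i → mk⇔ (uncurry ≤-antisym) (λ e → ≤-reflexive e , ≤-reflexive (sym e)))
    (decides-× (decides-≤ c c′) (decides-≤ c′ c))

  decides-∀< : {ρ : I → Vec ℕ n} {P : I × ℕ → Set} {b : I → ℕ} →
    Decides Y (ρ ▸) P → Computes Y ρ b → Decides Y ρ (λ i → ∀ k → k < b i → P (i , k))
  decides-∀< {P = P} (decides d) c = decides (recursion (λ i k → 𝟙 (∀ j → j < k → P (i , j)))
    (computes-cong (λ i → sym (𝟙-yes (λ _ ()))) (const-computes 1))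
    (computes-𝟙 (decides-cong
      (λ (i , k) → mk⇔
        (λ (below , at) j j<1+k → [ below j , (λ { refl → at }) ]′ (m<1+n⇒m<n∨m≡n j<1+k))
        (λ h → (λ j j<k → h j (m<n⇒m<1+n j<k)) , h k ≤-refl))
      (decides-× (decides (var 1F))
        (decides (compose id d (var 0F ◂ select (λ j → suc (suc j)) (λ _ _ → refl)))))))
    c)

  decides-∃< : {ρ : I → Vec ℕ n} {P : I × ℕ → Set} {b : I → ℕ} →
    Decides Y (ρ ▸) P → Computes Y ρ b → Decides Y ρ (λ i → ∃[ k ] (k < b i × P (i , k)))
  decides-∃< d c = decides-cong
    (λ i → mk⇔ (λ h → by-contradiction (λ ¬e → h (λ k k<b p → ¬e (k , k<b , p))))
               (λ (k , k<b , p) h → h k k<b p))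
    (decides-¬ (decides-∀< (decides-¬ d) c))

  search : {ρ : I → Vec ℕ n} {P : I × ℕ → Set} {v : I → ℕ} →
    Decides Y (ρ ▸) P → (∀ i → Least (λ k → P (i , k)) (v i)) → Computes Y ρ v
  -- `mu` stops at a zero, and `𝟙` of the negation is 0 exactly where `P` holds.
  search {Y = Y} {ρ = ρ} {P} {v} d l with decides-¬ d
  ... | decides (computes e c) =
    computes (mu e) (λ i → ⇓mu (run i (v i) 0 (+-identityʳ (v i))))
    where
    -- `j` is the number of candidates still to be rejected.
    run : ∀ i j k → j + k ≡ v i → Y ⊢mu e [ ρ i ]from k ⇓ v i
    run i zero k refl =
      found (subst (Y ⊢ e [ k ∷ ρ i ]⇓_) (𝟙-no (λ ¬p → ¬p (proj₁ (l i)))) (c (i , k)))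
    run i (suc j) k eq =
      next (subst (Y ⊢ e [ k ∷ ρ i ]⇓_) (𝟙-yes (proj₂ (l i) k (subst (k <_) eq (s≤s (m≤n+m k j))))) (c (i , k)))
           (run i j (suc k) (trans (+-suc j k) eq))

  decides-oracle : Computes Y ρ t → Decides Y ρ (Y ∘ t)
  decides-oracle {t = t} (computes e c) =
    decides (computes (comp oracle (e ∷ [])) (λ i → ⇓comp (⇓∷ (c i) ⇓[]) (⇓oracle (χ-𝟙 (t i)))))

  ≤T⇒decides : X ≤T Y → Decides Y unary X
  ≤T⇒decides {X = X} {Y = Y} (e , c) = decides (computes e λ x →
    let _ , isχ , d = c x in subst (Y ⊢ e [ unary x ]⇓_) (χ⇒𝟙 isχ) d)

  decides⇒≤T : Decides Y unary X → X ≤T Y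
  decides⇒≤T (decides (computes e c)) = e , λ x → _ , χ-𝟙 x , c x

  bound : X ≤wtt Y → ℕ → ℕ
  bound (_ , f , _) = f

  bound-computes : {W : Subset} (r : W ≤wtt X) → Computes Y unary (bound r)
  bound-computes (_ , _ , c , _) = computable-computes c

  -- The reduction on input `x i` queries only numbers below its use bound. Its oracle may thus be
  -- replaced by a decidable set, such as a finite stage of an enumeration, that agrees with `X` up
  -- to that bound and may be wrong beyond it.
  simulate : {W : Subset} (r : W ≤wtt X) {Q : ℕ × ℕ → Set} {p x : I → ℕ} →
    Decides Y binary Q → Computes Y ρ p → Computes Y ρ x →
    (∀ i y → y < bound r (x i) → Q (p i , y) ⇔ X y) → Decides Y ρ (W ∘ x)
  simulate {X = X} {Y = Y} {ρ = ρ} {W = W} (e , _ , _ , c) {Q} {p} {x} (decides (computes q cq)) cp cx agree = decides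
    (compose id (computes {ρ = λ i → p i ∷ x i ∷ []} (sim e) run) (cp ◂ cx ◂ nil))
    where
    open Simulation q
    run : ∀ i → Y ⊢ sim e [ p i ∷ x i ∷ [] ]⇓ 𝟙 (W (x i))
    run i with c (x i)
    ... | v , isχ , d , u = subst (Y ⊢ sim e [ p i ∷ x i ∷ [] ]⇓_) (χ⇒𝟙 isχ) (⇓sim answer d u)
      where
      answer : ∀ {y v} → y < _ → χ X y v → Y ⊢ q [ p i ∷ y ∷ [] ]⇓ v
      answer {y} y<b isχy =
        subst (Y ⊢ q [ p i ∷ y ∷ [] ]⇓_) (trans (𝟙-cong (agree i y y<b)) (sym (χ⇒𝟙 isχy))) (cq (p i , y))

  -- Counting the elements of an unbounded set.

  count : (ℕ → Set) → ℕ → ℕ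
  count P zero    = 0
  count P (suc x) = 𝟙 (P x) + count P x

  count-computes : {P : ℕ → Set} → Decides Y unary P → Computes Y unary (count P)
  count-computes d = recursion₁ _ (+-computes (computes-𝟙 (decides₁ d (var 0F))) (var 1F))

  count-constant : ∀ (P : ℕ → Set) {x y} → x ≤ y → (∀ d → x ≤ d → d < y → ¬ P d) → count P x ≡ count P y
  count-constant P {x} {zero} z≤n ¬p = refl
  count-constant P {x} {suc y} x≤1+y ¬p with m≤n⇒m<n∨m≡n x≤1+y
  ... | inj₂ refl  = refl
  ... | inj₁ (s≤s x≤y) = trans (count-constant P x≤y (λ d x≤d d<y → ¬p d x≤d (m<n⇒m<1+n d<y)))
    (cong (_+ count P y) (sym (𝟙-no (¬p y x≤y ≤-refl))))

  Unbounded : (ℕ → Set) → Set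
  Unbounded P = ∀ n → ∃[ x ] (n ≤ x × P x)

  infinite⇒unbounded : Infinite X → Unbounded X
  infinite⇒unbounded {X} inf n = by-contradiction λ none →
    inf (upTo n , λ x x∈X → ∈-upTo⁺ (≰⇒> (λ n≤x → none (x , n≤x , x∈X))))

  -- From a point where the count is `i`, the next element of `P` still has count `i`, and the
  -- number after that element has count `suc i`.
  count-surjective : {P : ℕ → Set} → Unbounded P → ∀ i → ∃[ d ] (P d × count P d ≡ i)
  count-surjective {P} unb i = from (reach i)
    where
    from : (∃[ x ] count P x ≡ i) → ∃[ d ] (P d × count P d ≡ i)
    from (x , eq) with least (λ d → x ≤ d × P d) (unb x)
    ... | d , (x≤d , p) , below = d , p , trans
      (sym (count-constant P x≤d (λ e x≤e e<d pe → below e e<d (x≤e , pe)))) eq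
    reach : ∀ i → ∃[ x ] count P x ≡ i
    reach zero = 0 , refl
    reach (suc i) with reach i
    ... | x , refl with least (λ d → x ≤ d × P d) (unb x)
    ... | d , (x≤d , p) , below = suc d , trans (cong (_+ count P d) (𝟙-yes p))
      (cong suc (sym (count-constant P x≤d (λ e x≤e e<d pe → below e e<d (x≤e , pe)))))

  -- Enumerating c.e. sets in stages.

  record Approximation (X : Subset) : Set₁ where
    field
      stage    : ℕ → Subset
      decidable : ∀ {Y} → Decides Y binary (uncurry stage)
      monotone : ∀ {s t x} → s ≤ t → stage s x → stage t x
      sound    : ∀ {s x} → stage s x → X x
      complete : ∀ {x} → X x → ∃[ s ] stage s x

  ce⇒approximation : CE X → Approximation X
  ce⇒approximation (inj₁ empty) = record
    { stage     = λ _ → ∅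
    ; decidable = decides (computes-cong (λ _ → sym (𝟙-no (λ ()))) (const-computes 0))
    ; monotone  = λ _ ()
    ; sound     = λ ()
    ; complete  = λ x∈X → ⊥-elim (empty _ x∈X)
    }
  ce⇒approximation (inj₂ (f , c , enum)) = record
    { stage     = λ s x → ∃[ k ] (k < s × f k ≡ x)
    ; decidable = decides-∃< (decides-≡ (apply₁ (computable-computes c) (var 0F)) (var 2F)) (var 0F)
    ; monotone  = λ s≤t (k , k<s , eq) → k , ≤-trans k<s s≤t , eq
    ; sound     = λ (k , _ , eq) → Equivalence.from (enum _) (k , eq)
    ; complete  = λ x∈X → let k , eq = Equivalence.to (enum _) x∈X in suc k , k , ≤-refl , eq
    }

  -- Use bounds and blocks.

  module Separation {A B : Subset} (α : Approximation A) (β : Approximation B)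
    (A≤B : A ≤wtt B) (B≤A : B ≤wtt A) where

    open Approximation

    D : Subset
    D = ∁ (A ∪ B)

    decides-D : Decides Y unary A → Decides Y unary B → Decides Y unary D
    decides-D a b = decides-¬ (decides-⊎ a b)

    width : ℕ → ℕ
    width x = suc (bound A≤B x + bound B≤A x)

    -- Summing the widths makes `h` monotone; the `suc` in `width` puts it above the identity, so
    -- that the block at `m` contains `m`.
    h : ℕ → ℕ
    h zero    = width 0
    h (suc x) = width (suc x) + h x

    h-computes : Computes Y unary h
    h-computes = recursion₁ h (+-computes (apply₁ width-computes (suc-computes (var 0F))) (var 1F))
      where
      width-computes : Computes Y unary width
      width-computes = suc-computes (+-computes (bound-computes A≤B) (bound-computes B≤A))

    width≤h : ∀ x → width x ≤ h x
    width≤h zero    = ≤-refl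
    width≤h (suc x) = m≤m+n _ _

    n<h : ∀ x → x < h x
    n<h zero    = s≤s z≤n
    n<h (suc x) = s≤s (≤-trans (n<h x) (m≤n+m _ _))

    h-mono : ∀ {x y} → x ≤ y → h x ≤ h y
    h-mono {x} {zero}  z≤n = ≤-refl
    h-mono {x} {suc y} x≤1+y with m≤n⇒m<n∨m≡n x≤1+y
    ... | inj₁ (s≤s x≤y) = ≤-trans (h-mono x≤y) (m≤n+m _ _)
    ... | inj₂ refl      = ≤-refl

    bound-A≤h : ∀ x → bound A≤B x ≤ h x
    bound-A≤h x = ≤-trans (m≤n⇒m≤1+n (m≤m+n _ _)) (width≤h x)

    bound-B≤h : ∀ x → bound B≤A x ≤ h x
    bound-B≤h x = ≤-trans (m≤n⇒m≤1+n (m≤n+m _ _)) (width≤h x)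

    Block : ℕ → (ℕ → Set) → Set
    Block m P = ∀ x → x < h m → m ≤ x → P x

    decides-Block : {m : I → ℕ} {P : I × ℕ → Set} → Computes Y ρ m → Decides Y (ρ ▸) P →
      Decides Y ρ (λ i → Block (m i) (λ x → P (i , x)))
    decides-Block c d = decides-∀< (decides-→ (decides-≤ (weaken c) (var 0F)) d) (apply₁ h-computes c)

    Covered : Approximation X → Subset → ℕ → ℕ → Set
    Covered γ W t m = Block m (λ x → W x → stage γ t x)

    covered-mono : ∀ (γ : Approximation X) {W s t m} → s ≤ t → Covered γ W s m → Covered γ W t m
    covered-mono γ s≤t cov x x<h m≤x w = monotone γ s≤t (cov x x<h m≤x w)

    -- A block is finite, so some stage exceeds all those at which its elements of `W` are
    -- enumerated.
    covered-exists : (γ : Approximation X) {W : Subset} → ∀ m →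
      Block m (λ x → W x → X x) → ∃[ t ] Covered γ W t m
    covered-exists {X = X} γ {W} m W⊆X =
      uniform-bound (λ x t → m ≤ x → W x → stage γ t x)
        (λ s≤t cov m≤x w → monotone γ s≤t (cov m≤x w)) (h m) pointwise
      where
      pointwise : ∀ x → x < h m → ∃[ t ] (m ≤ x → W x → stage γ t x)
      pointwise x x<h with em {m ≤ x × W x}
      ... | yes (m≤x , w) = let t , st = complete γ (W⊆X x x<h m≤x w) in t , λ _ _ → st
      ... | no ¬mw        = 0 , λ m≤x w → ⊥-elim (¬mw (m≤x , w))

    Homogeneous : Subset → ℕ → Set
    Homogeneous Z m = Block m (λ x → D x → ¬ Z x) ⊎ Block m (λ x → D x → Z x)

    -- Recovering `A` and `B` from a separator homogeneous on blocks.

    module Decoding {Z : Subset} (sep : Separator A B Z) where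

      A⊆Z : A ⊆ Z
      A⊆Z = proj₁ sep

      B∩Z : ∀ {x} → B x → ¬ Z x
      B∩Z b z = proj₂ sep _ (z , b)

      -- At such a stage t the block at m shows A = Z (respectively B = ∁ Z), so
      -- that no further element of A (respectively B) is enumerated into it.
      Decided : ℕ → ℕ → Set
      Decided t m = Covered α Z t m ⊎ Covered β (∁ Z) t m

      -- If `Z` avoids `D` on the block, a point of `Z` there is neither in `D` nor in `B`, hence in
      -- `A`. If `Z` contains `D` on the block, a point outside `Z` is neither in `D` nor in `A`,
      -- hence in `B`.
      decided-exists : ∀ s m → Homogeneous Z m → ∃[ t ] (s ≤ t × Decided t m)
      decided-exists s m (inj₁ out) =
        let t , cov = covered-exists α m (λ x x<h m≤x z → by-contradiction
                        (λ ¬a → out x x<h m≤x [ ¬a , (λ b → B∩Z b z) ]′ z))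
        in s ⊔ t , m≤m⊔n s t , inj₁ (covered-mono α (m≤n⊔m s t) cov)
      decided-exists s m (inj₂ within) =
        let t , cov = covered-exists β m (λ x x<h m≤x ¬z → by-contradiction
                        (λ ¬b → ¬z (within x x<h m≤x [ ¬z ∘ A⊆Z , ¬b ]′)))
        in s ⊔ t , m≤m⊔n s t , inj₂ (covered-mono β (m≤n⊔m s t) cov)

      decision : ∀ s m → Homogeneous Z m → ∃[ t ] Least (λ t → s ≤ t × Decided t m) t
      decision s m hom = least _ (decided-exists s m hom)

      decides-covered-A : ∀ {ρ : I → Vec ℕ n} {t m} → Computes Z ρ t → Computes Z ρ m →
        Decides Z ρ (λ i → Covered α Z (t i) (m i))
      decides-covered-A ct cm = decides-Block cm
        (decides-→ (decides-oracle (var 0F)) (decides₂ (decidable α) (weaken ct) (var 0F)))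

      decides-covered-B : ∀ {ρ : I → Vec ℕ n} {t m} → Computes Z ρ t → Computes Z ρ m →
        Decides Z ρ (λ i → Covered β (∁ Z) (t i) (m i))
      decides-covered-B ct cm = decides-Block cm
        (decides-→ (decides-¬ (decides-oracle (var 0F))) (decides₂ (decidable β) (weaken ct) (var 0F)))

      -- The condition searched for is a bounded statement about `Z` and the stages alone;
      -- homogeneity only guarantees that the search ends.
      decision-computes : ∀ {ρ : I → Vec ℕ n} {s m} → Computes Z ρ s → Computes Z ρ m →
        (hom : ∀ i → Homogeneous Z (m i)) → Computes Z ρ (λ i → proj₁ (decision (s i) (m i) (hom i)))
      decision-computes {s = s} {m} cs cm hom = search
        (decides-× (decides-≤ (weaken cs) (var 0F))
          (decides-⊎ (decides-covered-A (var 0F) (weaken cm)) (decides-covered-B (var 0F) (weaken cm))))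
        (λ i → proj₂ (decision (s i) (m i) (hom i)))

      module Homogeneously (hom : ∀ m → Homogeneous Z m) where

        caught-up : ∀ s m → ∃[ t ] (s ≤ t × (A m → stage α t m) × (B m → stage β t m))
        caught-up s m with em {A m} | em {B m}
        ... | no ¬a | no ¬b = s , ≤-refl , ⊥-elim ∘ ¬a , ⊥-elim ∘ ¬b
        ... | yes a | yes b = ⊥-elim (B∩Z b (A⊆Z a))
        ... | yes a | no ¬b = let t , st = complete α a in
          s ⊔ t , m≤m⊔n s t , (λ _ → monotone α (m≤n⊔m s t) st) , ⊥-elim ∘ ¬b
        ... | no ¬a | yes b = let t , st = complete β b in
          s ⊔ t , m≤m⊔n s t , ⊥-elim ∘ ¬a , (λ _ → monotone β (m≤n⊔m s t) st)

        catch-up : ∀ s m → ∃[ t ] Least (λ t → s ≤ t × (A m → stage α t m) × (B m → stage β t m)) t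
        catch-up s m = least _ (caught-up s m)

        -- A stage at which `A` and `B` have settled below `m`. It is defined by true membership in
        -- `A` and `B`, and proves computable in `Z` only after `decides-A-env` and `decides-B-env`.
        σ : ℕ → ℕ
        σ zero    = 0
        σ (suc m) = proj₁ (catch-up (σ m) m)

        σ-settled : ∀ m x → x < m → (A x → stage α (σ m) x) × (B x → stage β (σ m) x)
        σ-settled (suc m) x x<1+m with proj₁ (proj₂ (catch-up (σ m) m)) | m<1+n⇒m<n∨m≡n x<1+m
        ... | _ , a , b | inj₂ refl = a , b
        ... | s≤t , _   | inj₁ x<m  =
          let a , b = σ-settled m x x<m in monotone α s≤t ∘ a , monotone β s≤t ∘ b

        -- Supplying `σ m` as an input avoids a circle: membership of `m` is first decided from
        -- `σ m`, and this then yields the recursion step to `σ (suc m)`.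
        env : ℕ → Vec ℕ 2
        env m = m ∷ σ m ∷ []

        τ : ℕ → ℕ
        τ m = proj₁ (decision (σ m) m (hom m))

        σ≤τ : ∀ m → σ m ≤ τ m
        σ≤τ m = proj₁ (proj₁ (proj₂ (decision (σ m) m (hom m))))

        τ-decided : ∀ m → Decided (τ m) m
        τ-decided m = proj₂ (proj₁ (proj₂ (decision (σ m) m (hom m))))

        τ-computes : Computes Z env τ
        τ-computes = decision-computes (var 1F) (var 0F) hom

        -- Below `m`, `A` has settled by stage `σ m`, which is at most `τ m`. From `m` on, elements
        -- of `A` lie in `Z` and are therefore covered.
        A-settled : ∀ {m} → Covered α Z (τ m) m → ∀ x → x < h m → stage α (τ m) x ⇔ A x
        A-settled {m} cov x x<h = mk⇔ (sound α) settled
          where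
          settled : A x → stage α (τ m) x
          settled a with <-≤-connex x m
          ... | inj₁ x<m = monotone α (σ≤τ m) (proj₁ (σ-settled m x x<m) a)
          ... | inj₂ m≤x = cov x x<h m≤x (A⊆Z a)

        B-settled : ∀ {m} → ¬ Covered α Z (τ m) m → ∀ x → x < h m → stage β (τ m) x ⇔ B x
        B-settled {m} ¬cov x x<h = mk⇔ (sound β) settled
          where
          settled : B x → stage β (τ m) x
          settled b with <-≤-connex x m
          ... | inj₁ x<m = monotone β (σ≤τ m) (proj₂ (σ-settled m x x<m) b)
          -- The stage `τ m` is decided, so where `A` fails to cover `Z`, `B` covers the complement
          -- of `Z`.
          ... | inj₂ m≤x with τ-decided m
          ...   | inj₁ cov = ⊥-elim (¬cov cov)
          ...   | inj₂ cov = cov x x<h m≤x (B∩Z b)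

        covered : Decides Z env (λ m → Covered α Z (τ m) m)
        covered = decides-covered-A τ-computes (var 0F)

        -- If `Z` is covered, stage `τ m` of `A` is correct at `m`. Otherwise stage `τ m` of `B` is
        -- correct below `h m`, which bounds the use of the reduction of `A` to `B` on `m`.
        decides-A-env : Decides Z env A
        decides-A-env = decides-cases covered
          (decides-cong (λ (m , cov) → A-settled cov m (n<h m))
            (decides-reindex proj₁ (decides₂ (decidable α) τ-computes (var 0F))))
          (simulate A≤B (decidable β) (reindex proj₁ τ-computes) (var 0F)
            (λ (m , ¬cov) x x<b → B-settled ¬cov x (≤-trans x<b (bound-A≤h m))))

        decides-B-env : Decides Z env B
        decides-B-env = decides-cases covered
          (simulate B≤A (decidable α) (reindex proj₁ τ-computes) (var 0F)
            (λ (m , cov) x x<b → A-settled cov x (≤-trans x<b (bound-B≤h m))))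
          (decides-cong (λ (m , ¬cov) → B-settled ¬cov m (n<h m))
            (decides-reindex proj₁ (decides₂ (decidable β) τ-computes (var 0F))))

        σ-computes : Computes Z unary σ
        σ-computes = recursion₁ σ (search
          (decides-× (decides-≤ (weaken (var 1F)) (var 0F))
            (decides-× (decides-→ (decides-weaken decides-A-env) (decides₂ (decidable α) (var 0F) (weaken (var 0F))))
                       (decides-→ (decides-weaken decides-B-env) (decides₂ (decidable β) (var 0F) (weaken (var 0F))))))
          (λ m → proj₂ (catch-up (σ m) m)))

        decides-A : Decides Z unary A
        decides-A = decides-cong (λ x → mk⇔ (sound α) (proj₁ (σ-settled (suc x) x ≤-refl)))
          -- `σ m` settles only the numbers strictly below `m`, hence the successor.
          (decides₂ (decidable α) (apply₁ σ-computes (suc-computes (var 0F))) (var 0F))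

        decides-B : Decides Z unary B
        decides-B = decides-cong (λ x → mk⇔ (sound β) (proj₂ (σ-settled (suc x) x ≤-refl)))
          (decides₂ (decidable β) (apply₁ σ-computes (suc-computes (var 0F))) (var 0F))

    -- Coding `C` into a separator.

    module Coding (disjoint : Empty (A ∩ B)) (unboundedD : Unbounded D) (C : Subset) (A≤C : A ≤T C) where

      decides-A-C : Decides C unary A
      decides-A-C = ≤T⇒decides A≤C

      decides-B-C : Decides C unary B
      -- `C` decides `A` exactly, so no stage is involved and the parameter 0 is a dummy.
      decides-B-C = simulate B≤A (decides₁ decides-A-C (var 1F)) (const-computes 0) (var 0F) (λ _ _ _ → mk⇔ id id)

      A∪[D∩_] : Subset → Subset
      A∪[D∩ E ] = A ∪ (D ∩ E)

      separates : ∀ E → Separator A B A∪[D∩ E ]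
      separates E = inj₁ , λ x (z , b) → [ (λ a → disjoint x (a , b)) , (λ (¬ab , _) → ¬ab (inj₂ b)) ]′ z

      coded≤C : ∀ {E} → Decides C unary E → A∪[D∩ E ] ≤T C
      coded≤C e = decides⇒≤T (decides-⊎ decides-A-C (decides-× (decides-D decides-A-C decides-B-C) e))

      on-D : ∀ E {x} → D x → A∪[D∩ E ] x ⇔ E x
      on-D E ¬ab = mk⇔ [ ⊥-elim ∘ ¬ab ∘ inj₁ , proj₂ ]′ (λ e → inj₂ (¬ab , e))

      -- If D misses infinitely many blocks, those gaps cut D into finite pieces,
      -- and the bit C i is written on the i-th piece.
      module Gaps (gaps : Unbounded (λ m → Block m (∁ D))) where

        -- The elements that end a piece. Each is itself in `D`, so the bit of its piece can be read
        -- there.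
        Last : ℕ → Set
        Last d = D d × Block (suc d) (∁ D)

        decides-Last : Decides Y unary A → Decides Y unary B → Decides Y unary Last
        decides-Last a b = decides-× d (decides-Block (suc-computes (var 0F)) (decides-¬ (decides₁ d (var 0F))))
          where d = decides-D a b

        -- Descent from the gap to the greatest element of `D` below it: if `m` is not in `D`, the
        -- gap at `suc m` yields one at `m`, because `h m` is at most `h (suc m)`.
        last-before : ∀ n m → (∃[ d ] (n ≤ d × d < m × D d)) → Block m (∁ D) → ∃[ d ] (n ≤ d × Last d)
        last-before n (suc m) (d , n≤d , d<1+m , Dd) gap with em {D m}
        ... | yes Dm = m , ≤-trans n≤d (≤-pred d<1+m) , Dm , gap
        ... | no ¬Dm with m<1+n⇒m<n∨m≡n d<1+m
        ...   | inj₂ refl = ⊥-elim (¬Dm Dd)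
        ...   | inj₁ d<m  = last-before n m (d , n≤d , d<m , Dd) gap′
          where
          gap′ : Block m (∁ D)
          gap′ x x<h m≤x with m≤n⇒m<n∨m≡n m≤x
          ... | inj₁ m<x  = gap x (<-≤-trans x<h (h-mono (n≤1+n m))) m<x
          ... | inj₂ refl = ¬Dm

        unbounded-Last : Unbounded Last
        unbounded-Last n =
          let d , n≤d , Dd  = unboundedD n
              m , d<m , gap = gaps (suc d)
          in last-before n m (d , n≤d , d<m , Dd) gap

        -- The count is strict, so a last element belongs to the piece that it ends.
        piece : ℕ → ℕ
        piece = count Last

        Z : Subset
        Z = A∪[D∩ C ∘ piece ]

        -- A last element `d` with `x ≤ d < y` would leave the block at `suc d` free of `D`; but `y`
        -- is in `D` and in that block, as `y < h m ≤ h (suc d)`.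
        piece-constant : ∀ {m x y} → m ≤ x → y < h m → D y → x ≤ y → piece x ≡ piece y
        piece-constant m≤x y<h Dy x≤y = count-constant Last x≤y λ d x≤d d<y (_ , gap) →
          gap _ (<-≤-trans y<h (h-mono (m≤n⇒m≤1+n (≤-trans m≤x x≤d)))) d<y Dy

        same-piece : ∀ {m x y} → m ≤ x → x < h m → D x → m ≤ y → y < h m → D y → piece x ≡ piece y
        same-piece {x = x} {y} m≤x x<h Dx m≤y y<h Dy with ≤-total x y
        ... | inj₁ x≤y = piece-constant m≤x y<h Dy x≤y
        ... | inj₂ y≤x = sym (piece-constant m≤y x<h Dx y≤x)

        homogeneous : ∀ m → Homogeneous Z m
        homogeneous m with em {∃[ x ] (m ≤ x × x < h m × D x × Z x)}
        ... | no none = inj₁ λ x x<h m≤x Dx z → none (x , m≤x , x<h , Dx , z)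
        ... | yes (x , m≤x , x<h , Dx , z) = inj₂ λ y y<h m≤y Dy →
          inj₂ (Dy , subst C (same-piece m≤x x<h Dx m≤y y<h Dy) (Equivalence.to (on-D (C ∘ piece) Dx) z))

        open Decoding (separates (C ∘ piece))
        open Homogeneously homogeneous

        place : ∀ i → ∃[ d ] Least (λ d → Last d × piece d ≡ i) d
        place i = least _ (count-surjective unbounded-Last i)

        -- By homogeneity `Z` decides `A` and `B`, hence `Last`, and so can find the element that
        -- carries the bit `C i`.
        place-computes : Computes Z unary (proj₁ ∘ place)
        place-computes = search
          (decides-× (decides₁ last (var 0F)) (decides-≡ (apply₁ (count-computes last) (var 0F)) (var 1F)))
          (proj₂ ∘ place)
          where last = decides-Last decides-A decides-B

        read : ∀ i → Z (proj₁ (place i)) ⇔ C i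
        read i with place i
        ... | d , ((Dd , _) , refl) , _ = on-D (C ∘ piece) Dd

        C≤Z : C ≤T Z
        C≤Z = decides⇒≤T (decides-cong read (decides-oracle place-computes))

        Z≤C : Z ≤T C
        Z≤C = coded≤C (decides₁ (decides-oracle (var 0F))
          (count-computes (decides-Last decides-A-C decides-B-C)))

      -- If D meets every block from some point on, the bit C k is written on the
      -- k-th of a computable sequence of consecutive blocks.
      module NoGaps (start : ℕ) (meets : ∀ m → start ≤ m → ¬ Block m (∁ D)) where

        left : ℕ → ℕ
        left zero    = start
        left (suc k) = h (left k)

        left-computes : Computes Y unary left
        left-computes = recursion₁ left (apply₁ h-computes (var 1F))

        left-mono : ∀ {j k} → j ≤ k → left j ≤ left k
        left-mono {j} {k} j≤k with m≤n⇒m<n∨m≡n j≤k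
        left-mono {j} {suc k} _ | inj₁ (s≤s j≤k) = ≤-trans (left-mono j≤k) (<⇒≤ (n<h (left k)))
        ... | inj₂ refl = ≤-refl

        n≤left : ∀ k → k ≤ left k
        n≤left zero    = z≤n
        n≤left (suc k) = <-≤-trans (s≤s (n≤left k)) (n<h (left k))

        InBlock : ℕ → ℕ → Set
        InBlock x k = left k ≤ x × x < left (suc k)

        block-unique : ∀ {x j k} → InBlock x j → InBlock x k → j ≡ k
        block-unique {x} {j} {k} (lj , uj) (lk , uk) with <-cmp j k
        ... | tri≈ _ j≡k _ = j≡k
        ... | tri< j<k _ _ = ⊥-elim (<⇒≱ uj (≤-trans (left-mono j<k) lk))
        ... | tri> _ _ k<j = ⊥-elim (<⇒≱ uk (≤-trans (left-mono k<j) lj))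

        -- The bound on `k` makes the quantifier decidable and loses nothing, since
        -- `k ≤ left k ≤ x`.
        E : Subset
        E x = ∃[ k ] (k < suc x × C k × InBlock x k)

        decides-E : Decides C unary E
        decides-E = decides-∃<
          (decides-× (decides-oracle (var 0F))
            (decides-× (decides-≤ (apply₁ left-computes (var 0F)) (var 1F))
                       (decides-≤ (suc-computes (var 1F)) (apply₁ left-computes (suc-computes (var 0F))))))
          (suc-computes (var 0F))

        Z : Subset
        Z = A∪[D∩ E ]

        coded : ∀ k {x} → InBlock x k → D x → Z x ⇔ C k
        coded k inb Dx = mk⇔
          (λ z → let _ , _ , c , inb′ = Equivalence.to (on-D E Dx) z in subst C (block-unique inb′ inb) c)
          (λ c → Equivalence.from (on-D E Dx) (k , s≤s (≤-trans (n≤left k) (proj₁ inb)) , c , inb))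

        homogeneous : ∀ k → Homogeneous Z (left k)
        homogeneous k with em {C k}
        ... | yes c = inj₂ λ x x<h l≤x Dx → Equivalence.from (coded k (l≤x , x<h) Dx) c
        ... | no ¬c = inj₁ λ x x<h l≤x Dx z → ¬c (Equivalence.to (coded k (l≤x , x<h) Dx) z)

        open Decoding (separates E)

        τ : ℕ → ℕ
        -- The search may start at stage 0: only the bit is to be recovered, not `A` and `B` below
        -- the block.
        τ k = proj₁ (decision 0 (left k) (homogeneous k))

        τ-computes : Computes Z unary τ
        τ-computes = decision-computes (const-computes 0) left-computes homogeneous

        -- If `C k` holds, `Z` contains `D` on the block, so covering `Z` by `A` would make the
        -- block miss `D`. If `Z` is not covered, `B` covers its complement; were `C k` false, that
        -- complement would contain `D` on the block, which would again miss `D`.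
        read : ∀ k → (¬ Covered α Z (τ k) (left k)) ⇔ C k
        read k = mk⇔ to from
          where
          start≤left : start ≤ left k
          start≤left = left-mono {0} {k} z≤n
          from : C k → ¬ Covered α Z (τ k) (left k)
          from c cov = meets (left k) start≤left λ x x<h l≤x Dx →
            Dx (inj₁ (sound α (cov x x<h l≤x (Equivalence.from (coded k (l≤x , x<h) Dx) c))))
          to : ¬ Covered α Z (τ k) (left k) → C k
          to ¬cov with proj₂ (proj₁ (proj₂ (decision 0 (left k) (homogeneous k))))
          ... | inj₁ cov = ⊥-elim (¬cov cov)
          ... | inj₂ cov = by-contradiction λ ¬c → meets (left k) start≤left λ x x<h l≤x Dx →
            Dx (inj₂ (sound β (cov x x<h l≤x (¬c ∘ Equivalence.to (coded k (l≤x , x<h) Dx)))))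

        C≤Z : C ≤T Z
        C≤Z = decides⇒≤T (decides-cong read (decides-¬ (decides-covered-A τ-computes left-computes)))

        Z≤C : Z ≤T C
        Z≤C = coded≤C decides-E

      separator : ∃[ Z ] (Separator A B Z × Z ≡T C)
      -- This distinction need not be effective: each case has its own programs, and `n` enters them
      -- as a constant.
      separator with em {∃[ n ] (∀ m → n ≤ m → ¬ Block m (∁ D))}
      ... | yes (n , meets) = Z , separates E , Z≤C , C≤Z
        where open NoGaps n meets
      ... | no unmet = Z , separates (C ∘ piece) , Z≤C , C≤Z
        where
        open Gaps (λ n → by-contradiction λ none →
          unmet (n , λ m n≤m gap → none (m , n≤m , gap)))

theorem6 : ExcludedMiddle 0ℓ →
    (A B : Subset) → CE A → CE B → A ≡wtt B →
    Empty (A ∩ B) → Infinite (∁ (A ∪ B)) →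
    (C : Subset) → A ≤T C →
    ∃[ Z ] (Separator A B Z × Z ≡T C)
theorem6 em A B ceA ceB (A≤B , B≤A) disjoint infinite C A≤C = separator
  where
  open Classical em
  open Separation (ce⇒approximation ceA) (ce⇒approximation ceB) A≤B B≤A
  open Coding disjoint (infinite⇒unbounded infinite) C A≤C
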